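{- There exist, for each positive integer $m$, a nonempty set $B_m\subseteq\{0,1\}^m$, a total relation $f_m\subseteq B_m\times[m]$ and an error parameter $\varepsilon_m\in(0,1)$ such that, as $m\to\infty$, $$\overline{R}_0(f_m)=\Theta(1)\quad\text{and}\quad R_{\varepsilon_m}(f_m)=\Omega(m).$$
   Context: $[m]=\{1,\dots,m\}$. A relation $f\subseteq B\times\mathcal{Z}$, with $B\subseteq\{0,1\}^m$, is total if $f(x):=\{z\in\mathcal{Z}:(x,z)\in f\}$ is nonempty for every $x\in B$; only inputs in $B$ are considered. A deterministic query algorithm is a decision tree that adaptively queries single bits of the input; a randomized query algorithm $\mathcal{A}$ is a probability distribution over deterministic ones, $\mathcal{A}_r$ being the tree for internal randomness $r$ and $|\mathcal{A}_r(x)|$ the number of queries it makes on input $x$. $\overline{R}_0(f)$ is the infimum of $\max_{x\in B}\mathbf{E}_r[|\mathcal{A}_r(x)|]$ over randomized algorithms $\mathcal{A}$ with $\Pr_r[\mathcal{A}_r(x)\notin f(x)]=0$ for every $x\in B$. $R_\varepsilon(f)$ is the minimum of $\max_{x\in B,r}|\mathcal{A}_r(x)|$ over randomized algorithms $\mathcal{A}$ with $\Pr_r[\mathcal{A}_r(x)\notin f(x)]\le\varepsilon$ for every $x\in B$. -}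

module Defs where

open import Algebra.Bundles using (RawMonoid)
open import Data.Bool.Base using (Bool; true; false; T; if_then_else_)
open import Data.Fin.Base using (Fin)
open import Data.Integer.Base using (+_)
open import Data.List.Base as List using (List; []; _∷_; _++_; filterᵇ; allFin; cartesianProductWith)
open import Data.List.Extrema.Nat using (max)
open import Data.Nat.Base as ℕ using (ℕ; zero; suc; NonZero)
import Data.Nat.Properties as ℕ
open import Data.Product.Base using (Σ; Σ-syntax; ∃-syntax; _×_; _,_; proj₁)
open import Data.Rational.Base as ℚ using (ℚ; 0ℚ; 1ℚ; ½)
import Data.Rational.Properties as ℚ
open import Data.Vec.Base as Vec using (Vec; []; _∷_; lookup)
open import Level using (0ℓ)
open import Relation.Binary.PropositionalEquality using (_≡_; sym; trans; cong; subst)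

private
  half-pos : ∀ {δ} → 0ℚ ℚ.< δ → 0ℚ ℚ.< ½ ℚ.* δ
  half-pos {δ} 0<δ = subst (ℚ._< ½ ℚ.* δ) (ℚ.*-zeroʳ ½) (ℚ.*-monoʳ-<-pos ½ 0<δ)

  half+half : ∀ δ → ½ ℚ.* δ ℚ.+ ½ ℚ.* δ ≡ δ
  half+half δ = trans (sym (ℚ.*-distribʳ-+ δ ½ ½)) (ℚ.*-identityˡ δ)

  interchange : ∀ a b c d → (a ℚ.+ b) ℚ.+ (c ℚ.+ d) ≡ (a ℚ.+ c) ℚ.+ (b ℚ.+ d)
  interchange a b c d =
    trans (ℚ.+-assoc a b (c ℚ.+ d))
    (trans (cong (a ℚ.+_) (trans (sym (ℚ.+-assoc b c d))
                          (trans (cong (ℚ._+ d) (ℚ.+-comm b c)) (ℚ.+-assoc c b d))))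
           (sym (ℚ.+-assoc a c (b ℚ.+ d))))

  ≤+pos : ∀ p {δ} → 0ℚ ℚ.< δ → p ℚ.≤ p ℚ.+ δ
  ≤+pos p {δ} 0<δ = subst (ℚ._≤ p ℚ.+ δ) (ℚ.+-identityʳ p) (ℚ.+-monoʳ-≤ p (ℚ.<⇒≤ 0<δ))

  m⊔n≤o⇒m≤o : ∀ {m n o} → m ℕ.⊔ n ℕ.≤ o → m ℕ.≤ o
  m⊔n≤o⇒m≤o {m} {n} = ℕ.≤-trans (ℕ.m≤m⊔n m n)

  m⊔n≤o⇒n≤o : ∀ {m n o} → m ℕ.⊔ n ℕ.≤ o → n ℕ.≤ o
  m⊔n≤o⇒n≤o {m} {n} = ℕ.≤-trans (ℕ.m≤n⊔m m n)

------------------------------------------------------------------------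
-- Real numbers: Cauchy sequences of rationals

-- Since i and j range symmetrically, the last inequality says that
-- ∣ seq i - seq j ∣ ≤ δ.
record ℝ : Set where
  field
    seq    : ℕ → ℚ
    cauchy : ∀ δ → 0ℚ ℚ.< δ →
             ∃[ N ] ∀ i j → N ℕ.≤ i → N ℕ.≤ j → seq i ℚ.≤ seq j ℚ.+ δ

open ℝ public

infix 4 _≤ᴿ_ _<ᴿ_ _≃ᴿ_

_≤ᴿ_ : ℝ → ℝ → Set
x ≤ᴿ y = ∀ δ → 0ℚ ℚ.< δ → ∃[ N ] ∀ i → N ℕ.≤ i → seq x i ℚ.≤ seq y i ℚ.+ δ

_<ᴿ_ : ℝ → ℝ → Set
x <ᴿ y = ∃[ δ ] 0ℚ ℚ.< δ × ∃[ N ] ∀ i → N ℕ.≤ i → seq x i ℚ.+ δ ℚ.≤ seq y i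

_≃ᴿ_ : ℝ → ℝ → Set
x ≃ᴿ y = x ≤ᴿ y × y ≤ᴿ x

fromℚ : ℚ → ℝ
fromℚ q = record { seq = λ _ → q ; cauchy = λ δ 0<δ → 0 , λ _ _ _ _ → ≤+pos q 0<δ }

0ᴿ 1ᴿ : ℝ
0ᴿ = fromℚ 0ℚ
1ᴿ = fromℚ 1ℚ

infixl 6 _+ᴿ_ _⊔ᴿ_

_+ᴿ_ : ℝ → ℝ → ℝ
x +ᴿ y = record
  { seq    = λ i → seq x i ℚ.+ seq y i
  ; cauchy = λ δ 0<δ →
      let η      = ½ ℚ.* δ
          M , hx = cauchy x η (half-pos 0<δ)
          N , hy = cauchy y η (half-pos 0<δ)
      in M ℕ.⊔ N , λ i j p q →
        subst (seq x i ℚ.+ seq y i ℚ.≤_)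
          (trans (interchange (seq x j) η (seq y j) η)
                 (cong (seq x j ℚ.+ seq y j ℚ.+_) (half+half δ)))
          (ℚ.+-mono-≤ (hx i j (m⊔n≤o⇒m≤o p) (m⊔n≤o⇒m≤o q))
                      (hy i j (m⊔n≤o⇒n≤o {M} p) (m⊔n≤o⇒n≤o {M} q)))
  }

_⊔ᴿ_ : ℝ → ℝ → ℝ
x ⊔ᴿ y = record
  { seq    = λ i → seq x i ℚ.⊔ seq y i
  ; cauchy = λ δ 0<δ →
      let M , hx = cauchy x δ 0<δ
          N , hy = cauchy y δ 0<δ
      in M ℕ.⊔ N , λ i j p q →
        ℚ.⊔-lub
          (ℚ.≤-trans (hx i j (m⊔n≤o⇒m≤o p) (m⊔n≤o⇒m≤o q))
                     (ℚ.+-monoˡ-≤ δ (ℚ.p≤p⊔q (seq x j) (seq y j))))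
          (ℚ.≤-trans (hy i j (m⊔n≤o⇒n≤o {M} p) (m⊔n≤o⇒n≤o {M} q))
                     (ℚ.+-monoˡ-≤ δ (ℚ.p≤q⊔p (seq x j) (seq y j))))
  }

ℝ-rawMonoid : RawMonoid 0ℓ 0ℓ
ℝ-rawMonoid = record { Carrier = ℝ ; _≈_ = _≃ᴿ_ ; _∙_ = _+ᴿ_ ; ε = 0ᴿ }

open import Algebra.Definitions.RawMonoid ℝ-rawMonoid public
  using (sum) renaming (_×_ to infixr 8 _·_)

------------------------------------------------------------------------
-- Upper reals

-- Constructively the infimum of an inhabited family of non-negative reals
-- need not be a Cauchy real, but it always exists as an upper Dedekind cut
-- {q ∈ ℚ : q > infimum}.  Classically, the inhabited upper cuts bounded below
-- are exactly the real numbers (and the empty cut is +∞).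
record ℝᵘ : Set₁ where
  field
    Above   : ℚ → Set
    upward  : ∀ {p q} → p ℚ.< q → Above p → Above q
    rounded : ∀ {q} → Above q → ∃[ p ] p ℚ.< q × Above p

open ℝᵘ public

infix 4 _≤ᵘ_

_≤ᵘ_ : ℝᵘ → ℝᵘ → Set
u ≤ᵘ v = ∀ q → Above v q → Above u q

fromℚᵘ : ℚ → ℝᵘ
fromℚᵘ r = record
  { Above   = r ℚ.<_
  ; upward  = λ p<q r<p → ℚ.<-trans r<p p<q
  ; rounded = λ r<q → let p , r<p , p<q = ℚ.<-dense r<q in p , p<q , r<p
  }

infimum : {I : Set} → (I → ℝ) → ℝᵘ
infimum {I} x = record
  { Above   = λ q → Σ[ i ∈ I ] x i <ᴿ fromℚ q
  ; upward  = λ { p<q (i , δ , 0<δ , N , h) →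
                  i , δ , 0<δ , N , λ n N≤n → ℚ.≤-trans (h n N≤n) (ℚ.<⇒≤ p<q) }
  ; rounded = λ { {q} (i , δ , 0<δ , N , h) →
      let η = ½ ℚ.* δ in
        q ℚ.- η
      , subst (q ℚ.- η ℚ.<_) (ℚ.+-identityʳ q)
          (ℚ.+-monoʳ-< q (ℚ.neg-antimono-< (half-pos 0<δ)))
      , i , η , half-pos 0<δ , N
      , λ n N≤n → subst (ℚ._≤ q ℚ.- η) (cancel (seq (x i) n) δ)
                    (ℚ.+-monoˡ-≤ (ℚ.- η) (h n N≤n)) }
  }
  where
  cancel : ∀ a δ → (a ℚ.+ δ) ℚ.- ½ ℚ.* δ ≡ a ℚ.+ ½ ℚ.* δ
  cancel a δ =
    trans (ℚ.+-assoc a δ (ℚ.- η)) (cong (a ℚ.+_)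
    (trans (cong (ℚ._- η) (sym (half+half δ)))
    (trans (ℚ.+-assoc η η (ℚ.- η))
    (trans (cong (η ℚ.+_) (ℚ.+-inverseʳ η)) (ℚ.+-identityʳ η)))))
    where η = ½ ℚ.* δ

------------------------------------------------------------------------
-- Total relations f ⊆ B × Z with B ⊆ {0,1}ᵐ

Input : ℕ → Set
Input m = Vec Bool m

record TotalRelation (m : ℕ) (Z : Set) : Set where
  field
    dom      : Input m → Bool
    rel      : Input m → Z → Bool
    rel⊆dom  : ∀ x z → T (rel x z) → T (dom x)
    nonempty : ∃[ x ] T (dom x)
    total    : ∀ x → T (dom x) → ∃[ z ] T (rel x z)

open TotalRelation public

allInputs : ∀ m → List (Input m)
allInputs zero    = [] ∷ []
allInputs (suc m) = List.map (false ∷_) (allInputs m) ++ List.map (true ∷_) (allInputs m)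

domain : ∀ {m Z} → TotalRelation m Z → List (Input m)
domain {m} f = filterᵇ (dom f) (allInputs m)

------------------------------------------------------------------------
-- Query algorithms

data Tree (m : ℕ) (Z : Set) : Set where
  answer : Z → Tree m Z
  query  : Fin m → (Bool → Tree m Z) → Tree m Z

output : ∀ {m Z} → Tree m Z → Input m → Z
output (answer z)  x = z
output (query i t) x = output (t (lookup x i)) x

queries : ∀ {m Z} → Tree m Z → Input m → ℕ
queries (answer z)  x = 0
queries (query i t) x = suc (queries (t (lookup x i)) x)

-- The internal randomness r ranges over a finite set, with arbitrary real
-- probabilities.  This is no loss of generality for finite Z: skipping
-- repeated queries to a bit never increases the cost, and there are only
-- finitely many trees without repeated queries.
record RandomizedAlgorithm (m : ℕ) (Z : Set) : Set where
  field
    size   : ℕ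
    prob   : Fin size → ℝ
    prob≥0 : ∀ r → 0ᴿ ≤ᴿ prob r
    prob-1 : sum prob ≃ᴿ 1ᴿ
    tree   : Fin size → Tree m Z

open RandomizedAlgorithm public

module _ {m : ℕ} {Z : Set} (f : TotalRelation m Z) where

  errorProbability : RandomizedAlgorithm m Z → Input m → ℝ
  errorProbability A x =
    sum λ r → if rel f x (output (tree A r) x) then 0ᴿ else prob A r

  expectedQueries : RandomizedAlgorithm m Z → Input m → ℝ
  expectedQueries A x = sum λ r → queries (tree A r) x · prob A r

  -- The base values 0 are harmless: the quantities are non-negative and the
  -- domain is nonempty.
  maxExpectedQueries : RandomizedAlgorithm m Z → ℝ
  maxExpectedQueries A = List.foldr _⊔ᴿ_ 0ᴿ (List.map (expectedQueries A) (domain f))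

  maxQueries : RandomizedAlgorithm m Z → ℕ
  maxQueries A =
    max 0 (cartesianProductWith (λ x r → queries (tree A r) x) (domain f) (allFin (size A)))

  ZeroError : RandomizedAlgorithm m Z → Set
  ZeroError A = ∀ x → T (dom f x) → errorProbability A x ≃ᴿ 0ᴿ

  BoundedError : ℝ → RandomizedAlgorithm m Z → Set
  BoundedError ε A = ∀ x → T (dom f x) → errorProbability A x ≤ᴿ ε

  R̄₀ : ℝᵘ
  R̄₀ = infimum {Σ (RandomizedAlgorithm m Z) ZeroError} λ A → maxExpectedQueries (proj₁ A)

  -- IsR ε n : the minimum R_ε(f) is n.
  IsR : ℝ → ℕ → Set
  IsR ε n = (∃[ A ] BoundedError ε A × maxQueries A ≡ n)
          × (∀ A → BoundedError ε A → n ℕ.≤ maxQueries A)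

------------------------------------------------------------------------
-- Asymptotics of families indexed by positive integers

toℚ : ℕ → ℚ
toℚ n = + n ℚ./ 1

_∈Θ_ : ((m : ℕ) → .{{NonZero m}} → ℝᵘ) → (ℕ → ℕ) → Set
a ∈Θ g = ∃[ c ] ∃[ C ] 0ℚ ℚ.< c × 0ℚ ℚ.< C × ∃[ m₀ ]
  ∀ m .{{_ : NonZero m}} → m₀ ℕ.≤ m →
    fromℚᵘ (c ℚ.* toℚ (g m)) ≤ᵘ a m × a m ≤ᵘ fromℚᵘ (C ℚ.* toℚ (g m))

_∈Ω_ : ((m : ℕ) → .{{NonZero m}} → ℕ) → (ℕ → ℕ) → Set
a ∈Ω g = ∃[ c ] 0ℚ ℚ.< c × ∃[ m₀ ]
  ∀ m .{{_ : NonZero m}} → m₀ ℕ.≤ m → c ℚ.* toℚ (g m) ℚ.≤ toℚ (a m)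

{-# OPTIONS --safe #-}
module Submission where

-- Given x with at most k = ⌊ m /2⌋ zeros, find z with x_z = 1.  Probing random
-- positions succeeds with probability at least ½ per probe; after m failures a
-- deterministic scan finishes, so the expected number of queries is at most 3.
-- On the other hand, against a tree making fewer than k queries one can answer
-- every query by 0 and also set the bit of its final answer to 0, so the tree
-- errs on some input.  Summed over all inputs, the error of an algorithm of
-- worst-case cost less than k is thus at least 1, which is impossible when
-- every error is at most ε < 1 / |B|.

open import Defs
open import Algebra.Bundles using (CommutativeMonoid; CommutativeRing)
import Algebra.Properties.CommutativeMonoid.Sum as Sum
import Algebra.Properties.CommutativeSemigroup as CommutativeSemigroup
import Algebra.Properties.Semiring.Mult as SemiringMult
open import Data.Bool.Base using (true; false; T; if_then_else_; _∧_)
open import Data.Bool.Properties using (T?; ∧-zeroʳ; T-∧; T-≡)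
open import Data.Empty using (⊥-elim)
open import Data.Fin.Base using (Fin; zero; suc)
import Data.Fin.Properties as Fin
open import Data.Integer.Base as ℤ using (+_)
import Data.Integer.Properties as ℤ
open import Data.List.Base as List
  using (List; []; _∷_; length; allFin; cartesianProductWith)
open import Data.List.Extrema.Nat using (max≤v⁺; xs≤max)
open import Data.List.Membership.Propositional using (_∈_)
open import Data.List.Membership.Propositional.Properties
import Data.List.Properties as List
open import Data.List.Relation.Unary.All as All using (All; []; _∷_)
open import Data.List.Relation.Unary.Any as Any using (here; there)
open import Data.List.Relation.Unary.Any.Properties using (lookup-index)
open import Data.Nat.Base as ℕ using (ℕ; zero; suc; NonZero; z≤n; s≤s)
import Data.Nat.ListAction as ListAction
import Data.Nat.ListAction.Properties as ListAction
import Data.Nat.Properties as ℕ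
open import Data.Nat.Solver using (module +-*-Solver)
open import Data.Product.Base using (Σ-syntax; ∃-syntax; _×_; _,_; proj₁; proj₂)
open import Data.Rational.Base as ℚ using (ℚ; 0ℚ; 1ℚ; ½)
import Data.Rational.Properties as ℚ
import Data.Rational.Unnormalised.Base as ℚᵘ
import Data.Rational.Unnormalised.Properties as ℚᵘ
open import Data.Sum.Base using (_⊎_; inj₁; inj₂)
open import Data.Vec.Base using ([]; _∷_; lookup; replicate; _[_]≔_)
open import Data.Vec.Properties using (lookup∘update; lookup∘update′)
open import Function.Base using (_∘_; case_of_)
open import Function.Bundles using (Equivalence)
open import Level using (0ℓ)
open import Relation.Binary.Bundles using (Preorder)
import Relation.Binary.Reasoning.Preorder as PreorderReasoning
open import Relation.Binary.PropositionalEquality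
  using (_≡_; refl; sym; trans; cong; cong₂; subst; subst₂)
open import Relation.Nullary using (¬_; yes; no; contradiction)

open Equivalence using (to; from)

-- Order and finite sums of reals

half-pos : ∀ {δ} → 0ℚ ℚ.< δ → 0ℚ ℚ.< ½ ℚ.* δ
half-pos {δ} 0<δ = subst (ℚ._< ½ ℚ.* δ) (ℚ.*-zeroʳ ½) (ℚ.*-monoʳ-<-pos ½ 0<δ)

half+half : ∀ δ → ½ ℚ.* δ ℚ.+ ½ ℚ.* δ ≡ δ
half+half δ = trans (sym (ℚ.*-distribʳ-+ δ ½ ½)) (ℚ.*-identityˡ δ)

+-half+half : ∀ p δ → p ℚ.+ ½ ℚ.* δ ℚ.+ ½ ℚ.* δ ≡ p ℚ.+ δ
+-half+half p δ = trans (ℚ.+-assoc p _ _) (cong (p ℚ.+_) (half+half δ))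

infix 4 _⊑_ _≈_

-- _≤ᴿ_ unfolds to a function type, from which x and y cannot be inferred.
record _⊑_ (x y : ℝ) : Set where
  constructor ≤ᴿ⇒⊑
  field ⊑⇒≤ᴿ : x ≤ᴿ y

open _⊑_

_≈_ : ℝ → ℝ → Set
x ≈ y = x ⊑ y × y ⊑ x

⊑-pointwise : ∀ {x y} → (∀ i → seq x i ℚ.≤ seq y i) → x ⊑ y
⊑-pointwise {x} {y} x≤y .⊑⇒≤ᴿ δ 0<δ = 0 , λ i _ →
  ℚ.≤-trans (x≤y i) (subst (ℚ._≤ seq y i ℚ.+ δ) (ℚ.+-identityʳ _)
                           (ℚ.+-monoʳ-≤ (seq y i) (ℚ.<⇒≤ 0<δ)))

≈-pointwise : ∀ {x y} → (∀ i → seq x i ≡ seq y i) → x ≈ y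
≈-pointwise x≡y = ⊑-pointwise (ℚ.≤-reflexive ∘ x≡y)
                , ⊑-pointwise (ℚ.≤-reflexive ∘ sym ∘ x≡y)

⊑-refl : ∀ {x} → x ⊑ x
⊑-refl = ⊑-pointwise (λ _ → ℚ.≤-refl)

⊑-trans : ∀ {x y z} → x ⊑ y → y ⊑ z → x ⊑ z
⊑-trans {x} {y} {z} x≤y y≤z .⊑⇒≤ᴿ δ 0<δ =
  let M , hx = ⊑⇒≤ᴿ x≤y (½ ℚ.* δ) (half-pos 0<δ)
      N , hy = ⊑⇒≤ᴿ y≤z (½ ℚ.* δ) (half-pos 0<δ)
  in M ℕ.⊔ N , λ i p →
    ℚ.≤-trans (hx i (ℕ.m⊔n≤o⇒m≤o M N p))
      (subst (seq y i ℚ.+ ½ ℚ.* δ ℚ.≤_) (+-half+half (seq z i) δ)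
        (ℚ.+-monoˡ-≤ (½ ℚ.* δ) (hy i (ℕ.m⊔n≤o⇒n≤o M N p))))

≈-trans : ∀ {x y z} → x ≈ y → y ≈ z → x ≈ z
≈-trans (p , q) (r , s) = ⊑-trans p r , ⊑-trans s q

-- Half of the gap between `y` and `z` absorbs the slack allowed by `x ⊑ y`; the other half remains
-- as the gap between `x` and `z`.
⊑-<ᴿ-trans : ∀ {x y z} → x ⊑ y → y <ᴿ z → x <ᴿ z
⊑-<ᴿ-trans {x} {y} {z} x≤y (δ , 0<δ , N , hy) =
  let M , hx = ⊑⇒≤ᴿ x≤y (½ ℚ.* δ) (half-pos 0<δ)
  in ½ ℚ.* δ , half-pos 0<δ , M ℕ.⊔ N , λ i p →
    ℚ.≤-trans (ℚ.+-monoˡ-≤ (½ ℚ.* δ) (hx i (ℕ.m⊔n≤o⇒m≤o M N p)))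
      (subst (ℚ._≤ seq z i) (sym (+-half+half (seq y i) δ))
        (hy i (ℕ.m⊔n≤o⇒n≤o M N p)))

fromℚ-mono-< : ∀ {p q} → p ℚ.< q → fromℚ p <ᴿ fromℚ q
fromℚ-mono-< {p} {q} p<q =
    q ℚ.- p
  , subst (ℚ._< q ℚ.- p) (ℚ.+-inverseʳ p) (ℚ.+-monoˡ-< (ℚ.- p) p<q)
  , 0 , λ _ _ → ℚ.≤-reflexive
      (trans (cong (p ℚ.+_) (ℚ.+-comm q (ℚ.- p)))
      (trans (sym (ℚ.+-assoc p (ℚ.- p) q))
      (trans (cong (ℚ._+ q) (ℚ.+-inverseʳ p)) (ℚ.+-identityˡ q))))

fromℚ-cancel-< : ∀ {p q} → fromℚ p <ᴿ fromℚ q → p ℚ.< q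
fromℚ-cancel-< {p} (δ , 0<δ , N , h) =
  ℚ.<-≤-trans (subst (ℚ._< p ℚ.+ δ) (ℚ.+-identityʳ p) (ℚ.+-monoʳ-< p 0<δ)) (h N ℕ.≤-refl)

⊑⇒≯ᴿ : ∀ {x y} → x ⊑ y → ¬ y <ᴿ x
⊑⇒≯ᴿ {x} {y} x≤y y<x =
  let δ , 0<δ , N , h = ⊑-<ᴿ-trans {x} {y} {x} x≤y y<x
      x<x+δ = subst (ℚ._< seq x N ℚ.+ δ) (ℚ.+-identityʳ _) (ℚ.+-monoʳ-< (seq x N) 0<δ)
  in ℚ.<-irrefl refl (ℚ.<-≤-trans x<x+δ (h N ℕ.≤-refl))

+ᴿ-mono-≤ : ∀ {x y u v} → x ⊑ y → u ⊑ v → x +ᴿ u ⊑ y +ᴿ v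
+ᴿ-mono-≤ {x} {y} {u} {v} x≤y u≤v .⊑⇒≤ᴿ δ 0<δ =
  let η      = ½ ℚ.* δ
      M , hx = ⊑⇒≤ᴿ x≤y η (half-pos 0<δ)
      N , hu = ⊑⇒≤ᴿ u≤v η (half-pos 0<δ)
  in M ℕ.⊔ N , λ i p →
    subst (seq x i ℚ.+ seq u i ℚ.≤_)
      (trans (interchange (seq y i) η (seq v i) η)
             (cong (seq y i ℚ.+ seq v i ℚ.+_) (half+half δ)))
      (ℚ.+-mono-≤ (hx i (ℕ.m⊔n≤o⇒m≤o M N p)) (hu i (ℕ.m⊔n≤o⇒n≤o M N p)))
  where
  open CommutativeSemigroup (CommutativeMonoid.commutativeSemigroup ℚ.+-0-commutativeMonoid)
    using (interchange)

⊑-preorder : Preorder 0ℓ 0ℓ 0ℓ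
⊑-preorder = record
  { Carrier = ℝ ; _≈_ = _≈_ ; _≲_ = _⊑_
  ; isPreorder = record
    { isEquivalence = record
      { refl  = ⊑-refl , ⊑-refl
      ; sym   = λ (p , q) → q , p
      ; trans = ≈-trans
      }
    ; reflexive = proj₁
    ; trans     = ⊑-trans
    }
  }

module ⊑-Reasoning = PreorderReasoning ⊑-preorder

+ᴿ-identityˡ : ∀ x → 0ᴿ +ᴿ x ≈ x
+ᴿ-identityˡ x = ≈-pointwise (ℚ.+-identityˡ ∘ seq x)

+ᴿ-identityʳ : ∀ x → x +ᴿ 0ᴿ ≈ x
+ᴿ-identityʳ x = ≈-pointwise (ℚ.+-identityʳ ∘ seq x)

module ℚ-Sum = Sum ℚ.+-0-commutativeMonoid

open SemiringMult (CommutativeRing.semiring ℚ.+-*-commutativeRing) using () renaming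
  ( _×_ to _×ℚ_; ×-homo-+ to ×ℚ-homo-+; ×-assocˡ to ×ℚ-assocˡ; ×-assoc-* to ×ℚ-assoc-* )

-- Addition of reals acts index by index on the sequences, so identities of finite sums are
-- inherited from the rationals.
seq-sum : ∀ {n} (u : Fin n → ℝ) i → seq (sum u) i ≡ ℚ-Sum.sum (λ j → seq (u j) i)
seq-sum {zero}  u i = refl
seq-sum {suc n} u i = cong (seq (u zero) i ℚ.+_) (seq-sum (u ∘ suc) i)

seq-· : ∀ n x i → seq (n · x) i ≡ n ×ℚ seq x i
seq-· zero    x i = refl
seq-· (suc n) x i = cong (seq x i ℚ.+_) (seq-· n x i)

sum-replicate : ∀ n x → sum {n} (λ _ → x) ≈ n · x
sum-replicate n x = ≈-pointwise λ i →
  trans (seq-sum {n} (λ _ → x) i) (trans (ℚ-Sum.sum-replicate n) (sym (seq-· n x i)))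

sum-replicate-zero : ∀ n → sum {n} (λ _ → 0ᴿ) ≈ 0ᴿ
sum-replicate-zero n = ≈-pointwise λ i →
  trans (seq-sum {n} (λ _ → 0ᴿ) i) (ℚ-Sum.sum-replicate-zero n)

∑-distrib-+ : ∀ {n} (u v : Fin n → ℝ) → sum (λ j → u j +ᴿ v j) ≈ sum u +ᴿ sum v
∑-distrib-+ u v = ≈-pointwise λ i →
  trans (seq-sum (λ j → u j +ᴿ v j) i)
  (trans (ℚ-Sum.∑-distrib-+ (λ j → seq (u j) i) (λ j → seq (v j) i))
         (sym (cong₂ ℚ._+_ (seq-sum u i) (seq-sum v i))))

∑-comm : ∀ {m n} (u : Fin m → Fin n → ℝ) →
         sum (λ j → sum λ k → u j k) ≈ sum (λ k → sum λ j → u j k)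
∑-comm u = ≈-pointwise λ i →
  trans (seq-∑∑ u i)
  (trans (ℚ-Sum.∑-comm (λ j k → seq (u j k) i)) (sym (seq-∑∑ (λ k j → u j k) i)))
  where
  seq-∑∑ : ∀ {m n} (u : Fin m → Fin n → ℝ) i →
           seq (sum λ j → sum (u j)) i ≡ ℚ-Sum.sum (λ j → ℚ-Sum.sum λ k → seq (u j k) i)
  seq-∑∑ u i = trans (seq-sum (λ j → sum (u j)) i) (ℚ-Sum.sum-cong-≗ λ j → seq-sum (u j) i)

∑-· : ∀ {n} (q : Fin n → ℕ) x → sum (λ j → q j · x) ≈ ListAction.sum (List.tabulate q) · x
∑-· q x = ≈-pointwise (pointwise q)
  where
  pointwise : ∀ {n} (q : Fin n → ℕ) i →
              seq (sum λ j → q j · x) i ≡ seq (ListAction.sum (List.tabulate q) · x) i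
  pointwise {zero}  q i = refl
  pointwise {suc n} q i =
    trans (cong₂ ℚ._+_ (seq-· (q zero) x i) (trans (pointwise (q ∘ suc) i) (seq-· Q x i)))
    (trans (sym (×ℚ-homo-+ (seq x i) (q zero) Q)) (sym (seq-· (q zero ℕ.+ Q) x i)))
    where Q = ListAction.sum (List.tabulate (q ∘ suc))

x≤y+x : ∀ {x y} → 0ᴿ ⊑ y → x ⊑ y +ᴿ x
x≤y+x {x} 0≤y = ⊑-trans (proj₂ (+ᴿ-identityˡ x)) (+ᴿ-mono-≤ {u = x} 0≤y ⊑-refl)

x≤x+y : ∀ {x y} → 0ᴿ ⊑ y → x ⊑ x +ᴿ y
x≤x+y {x} 0≤y = ⊑-trans (proj₂ (+ᴿ-identityʳ x)) (+ᴿ-mono-≤ {x} ⊑-refl 0≤y)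

sum-mono-≤ : ∀ {n} {u v : Fin n → ℝ} → (∀ i → u i ⊑ v i) → sum u ⊑ sum v
sum-mono-≤ {zero}  u≤v = ⊑-refl
sum-mono-≤ {suc n} u≤v = +ᴿ-mono-≤ (u≤v zero) (sum-mono-≤ (u≤v ∘ suc))

sum-cong : ∀ {n} {u v : Fin n → ℝ} → (∀ i → u i ≈ v i) → sum u ≈ sum v
sum-cong u≈v = sum-mono-≤ (proj₁ ∘ u≈v) , sum-mono-≤ (proj₂ ∘ u≈v)

sum≥0 : ∀ {n} {u : Fin n → ℝ} → (∀ i → 0ᴿ ⊑ u i) → 0ᴿ ⊑ sum u
sum≥0 {n} 0≤u = ⊑-trans (proj₂ (sum-replicate-zero n)) (sum-mono-≤ 0≤u)

term≤sum : ∀ {n} {u : Fin n → ℝ} → (∀ i → 0ᴿ ⊑ u i) → ∀ i → u i ⊑ sum u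
term≤sum 0≤u zero    = x≤x+y (sum≥0 (0≤u ∘ suc))
term≤sum 0≤u (suc i) = ⊑-trans (term≤sum (0≤u ∘ suc) i) (x≤y+x (0≤u zero))

·≥0 : ∀ n {x} → 0ᴿ ⊑ x → 0ᴿ ⊑ n · x
·≥0 zero    0≤x = ⊑-refl
·≥0 (suc n) 0≤x = ⊑-trans (·≥0 n 0≤x) (x≤y+x 0≤x)

·-monoˡ-≤ : ∀ {x} → 0ᴿ ⊑ x → ∀ {m n} → m ℕ.≤ n → m · x ⊑ n · x
·-monoˡ-≤ 0≤x {n = n} z≤n     = ·≥0 n 0≤x
·-monoˡ-≤ {x} 0≤x (s≤s m≤n) = +ᴿ-mono-≤ {x} ⊑-refl (·-monoˡ-≤ 0≤x m≤n)

×1-nonNegative : ∀ n → 0ℚ ℚ.≤ n ×ℚ 1ℚ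
×1-nonNegative zero    = ℚ.≤-refl
×1-nonNegative (suc n) = ℚ.+-mono-≤ (ℚ.nonNegative⁻¹ 1ℚ) (×1-nonNegative n)

-- Taking `w` as the inverse of `n ×ℚ 1ℚ` matches `_·_`, which is repeated addition. The equation
-- holds exactly at every index, so no slack has to be carried along.
reciprocal : ∀ n .{{_ : NonZero n}} → ∃[ w ] 0ℚ ℚ.< w × (∀ i → seq (n · fromℚ w) i ≡ 1ℚ)
reciprocal n@(suc n-1) = w , ℚ.positive⁻¹ w , λ i →
  trans (seq-· n (fromℚ w) i)
  (trans (cong (n ×ℚ_) (sym (ℚ.*-identityˡ w)))
  (trans (sym (×ℚ-assoc-* n 1ℚ w)) (ℚ.*-inverseʳ (n ×ℚ 1ℚ))))
  where
  instance
    n-pos : ℚ.Positive (n ×ℚ 1ℚ)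
    n-pos = ℚ.positive (ℚ.+-mono-<-≤ (ℚ.positive⁻¹ 1ℚ) (×1-nonNegative n-1))
    n≢0 : ℚ.NonZero (n ×ℚ 1ℚ)
    n≢0 = ℚ.pos⇒nonZero (n ×ℚ 1ℚ)
    w-pos : ℚ.Positive (ℚ.1/ (n ×ℚ 1ℚ))
    w-pos = ℚ.1/pos⇒pos (n ×ℚ 1ℚ)
  w : ℚ
  w = ℚ.1/ (n ×ℚ 1ℚ)

-- The one missing copy of `w` is itself the gap.
·-<-1 : ∀ n {w} → 0ℚ ℚ.< w → (∀ i → seq (suc n · fromℚ w) i ≡ 1ℚ) → n · fromℚ w <ᴿ 1ᴿ
·-<-1 n {w} 0<w 1+n·w≡1 =
  w , 0<w , 0 , λ i _ → ℚ.≤-reflexive (trans (ℚ.+-comm _ w) (1+n·w≡1 i))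

-- Averaging over the random tree

∈-allInputs : ∀ {m} (x : Input m) → x ∈ allInputs m
∈-allInputs []          = here refl
∈-allInputs (false ∷ x) = ∈-++⁺ˡ (∈-map⁺ (false ∷_) (∈-allInputs x))
∈-allInputs {suc m} (true ∷ x) =
  ∈-++⁺ʳ (List.map (false ∷_) (allInputs m)) (∈-map⁺ (true ∷_) (∈-allInputs x))

foldr-⊔ᴿ-upper : ∀ {A : Set} (u : A → ℝ) {x xs} → x ∈ xs → u x ⊑ List.foldr _⊔ᴿ_ 0ᴿ (List.map u xs)
foldr-⊔ᴿ-upper u {x} {_ ∷ xs} (here refl) = ⊑-pointwise λ i → ℚ.p≤p⊔q (seq (u x) i) _
foldr-⊔ᴿ-upper u {x} {y ∷ xs} (there x∈xs) =
  ⊑-trans (foldr-⊔ᴿ-upper u x∈xs) (⊑-pointwise λ i → ℚ.p≤q⊔p (seq (u y) i) _)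

⊔ᴿ-lub : ∀ {x y z} → x ⊑ z → y ⊑ z → x ⊔ᴿ y ⊑ z
⊔ᴿ-lub x≤z y≤z .⊑⇒≤ᴿ δ 0<δ =
  let M , hx = ⊑⇒≤ᴿ x≤z δ 0<δ
      N , hy = ⊑⇒≤ᴿ y≤z δ 0<δ
  in M ℕ.⊔ N , λ i p →
    ℚ.⊔-lub (hx i (ℕ.m⊔n≤o⇒m≤o M N p)) (hy i (ℕ.m⊔n≤o⇒n≤o M N p))

foldr-⊔ᴿ-least : ∀ {A : Set} (u : A → ℝ) xs {y} → 0ᴿ ⊑ y →
                 (∀ {x} → x ∈ xs → u x ⊑ y) → List.foldr _⊔ᴿ_ 0ᴿ (List.map u xs) ⊑ y
foldr-⊔ᴿ-least u []       0≤y u≤y = 0≤y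
foldr-⊔ᴿ-least u (x ∷ xs) 0≤y u≤y =
  ⊔ᴿ-lub {u x} (u≤y (here refl)) (foldr-⊔ᴿ-least u xs 0≤y (u≤y ∘ there))

module _ {m : ℕ} {Z : Set} (f : TotalRelation m Z) where

  ∈-domain⁺ : ∀ {x} → T (dom f x) → x ∈ domain f
  ∈-domain⁺ {x} x∈B = ∈-filter⁺ (T? ∘ dom f) (∈-allInputs x) x∈B

  ∈-domain⁻ : ∀ {x} → x ∈ domain f → T (dom f x)
  ∈-domain⁻ x∈ = proj₂ (∈-filter⁻ (T? ∘ dom f) {xs = allInputs m} x∈)

  Errs : Tree m Z → Set
  Errs t = ∃[ x ] T (dom f x) × rel f x (output t x) ≡ false

  ZeroErrorTree : Tree m Z → Set
  ZeroErrorTree t = ∀ x → T (dom f x) → rel f x (output t x) ≡ true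

  queries≤maxQueries : ∀ A {x} → T (dom f x) → ∀ r → queries (tree A r) x ℕ.≤ maxQueries f A
  queries≤maxQueries A x∈B r = All.lookup (xs≤max 0 _)
    (∈-cartesianProductWith⁺ (λ x r → queries (tree A r) x) (∈-domain⁺ x∈B) (∈-allFin r))

  maxQueries≤ : ∀ A {n} → (∀ {x} → T (dom f x) → ∀ r → queries (tree A r) x ℕ.≤ n) →
                maxQueries f A ℕ.≤ n
  maxQueries≤ A q≤n = max≤v⁺ z≤n
    (All.tabulate λ v∈ → case ∈-cartesianProductWith⁻ _ (domain f) (allFin (size A)) v∈ of
      λ { (x , r , x∈ , _ , refl) → q≤n (∈-domain⁻ x∈) r })

  module _ (A : RandomizedAlgorithm m Z) where

    inputs : Fin (length (domain f)) → Input m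
    inputs = List.lookup (domain f)

    -- The summand of `errorProbability`, named so that the sums over inputs and over randomness can
    -- be exchanged.
    lossOn : Input m → Fin (size A) → ℝ
    lossOn x r = if rel f x (output (tree A r) x) then 0ᴿ else prob A r

    lossOn≥0 : ∀ x r → 0ᴿ ⊑ lossOn x r
    lossOn≥0 x r with rel f x (output (tree A r) x)
    ... | true  = ⊑-refl
    ... | false = ≤ᴿ⇒⊑ (prob≥0 A r)

    -- The probability of a bad tree is charged to the inputs on which it errs, so
    -- that no tree needs to be located by comparing real probabilities.
    errs⇒prob⊑losses : ∀ r → Errs (tree A r) → prob A r ⊑ sum λ j → lossOn (inputs j) r
    errs⇒prob⊑losses r (x , x∈B , x-err) =
      subst (_⊑ sum λ j → lossOn (inputs j) r) lossⱼ≡prob (term≤sum (λ j → lossOn≥0 (inputs j) r) j)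
      where
      x∈ = ∈-domain⁺ x∈B
      j = Any.index x∈
      lossⱼ≡prob : lossOn (inputs j) r ≡ prob A r
      lossⱼ≡prob = trans (cong (λ y → lossOn y r) (sym (lookup-index x∈)))
                         (cong (λ b → if b then 0ᴿ else prob A r) x-err)

    totalError : ℝ
    totalError = sum λ j → errorProbability f A (inputs j)

    -- The probabilities sum to 1, and each is paid partly by `q r` and partly by the losses of tree
    -- `r`. Summing the losses over `r` first turns them into error probabilities.
    1⊑sum+totalError : (q : Fin (size A) → ℝ) →
      (∀ r → prob A r ⊑ q r +ᴿ sum λ j → lossOn (inputs j) r) → 1ᴿ ⊑ sum q +ᴿ totalError
    1⊑sum+totalError q p≤ = begin
      1ᴿ                                                  ≲⟨ ≤ᴿ⇒⊑ (proj₂ (prob-1 A)) ⟩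
      sum (prob A)                                        ≲⟨ sum-mono-≤ p≤ ⟩
      sum (λ r → q r +ᴿ sum (λ j → lossOn (inputs j) r))  ≈⟨ ∑-distrib-+ q _ ⟩
      sum q +ᴿ sum (λ r → sum (λ j → lossOn (inputs j) r))
        ≲⟨ +ᴿ-mono-≤ {sum q} ⊑-refl (proj₁ (∑-comm λ r j → lossOn (inputs j) r)) ⟩
      sum q +ᴿ totalError                                 ∎
      where open ⊑-Reasoning

    expectedQueries⊑max : ∀ {x} → T (dom f x) → expectedQueries f A x ⊑ maxExpectedQueries f A
    expectedQueries⊑max x∈B = foldr-⊔ᴿ-upper (expectedQueries f A) (∈-domain⁺ x∈B)

    -- A tree that errs has its probability covered by its losses, which vanish in total under zero
    -- error. Any other tree makes a query on the fixed input `x`, so its probability is covered by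
    -- its share of the expected cost at `x`.
    zeroError⇒1⊑max : ZeroError f A → (∀ r → Errs (tree A r) ⊎ (∀ x → 1 ℕ.≤ queries (tree A r) x)) →
                      1ᴿ ⊑ maxExpectedQueries f A
    zeroError⇒1⊑max noErr dichotomy = begin
      1ᴿ ≲⟨ 1⊑sum+totalError (λ r → queries (tree A r) x · prob A r) (λ r → bound r (dichotomy r)) ⟩
      expectedQueries f A x +ᴿ totalError
        ≲⟨ +ᴿ-mono-≤ {expectedQueries f A x} ⊑-refl (sum-mono-≤ noErrⱼ) ⟩
      expectedQueries f A x +ᴿ sum {length (domain f)} (λ _ → 0ᴿ)
        ≲⟨ +ᴿ-mono-≤ {expectedQueries f A x} ⊑-refl (proj₁ (sum-replicate-zero (length (domain f)))) ⟩
      expectedQueries f A x +ᴿ 0ᴿ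
        ≈⟨ +ᴿ-identityʳ (expectedQueries f A x) ⟩
      expectedQueries f A x
        ≲⟨ expectedQueries⊑max x∈B ⟩
      maxExpectedQueries f A ∎
      where
      open ⊑-Reasoning
      x = proj₁ (nonempty f)
      x∈B = proj₂ (nonempty f)
      noErrⱼ : ∀ j → errorProbability f A (inputs j) ⊑ 0ᴿ
      noErrⱼ j = ≤ᴿ⇒⊑ (proj₁ (noErr (inputs j) (∈-domain⁻ (∈-lookup j))))
      p≥0 : ∀ r → 0ᴿ ⊑ prob A r
      p≥0 r = ≤ᴿ⇒⊑ (prob≥0 A r)
      bound : ∀ r → Errs (tree A r) ⊎ (∀ x → 1 ℕ.≤ queries (tree A r) x) →
              prob A r ⊑ queries (tree A r) x · prob A r +ᴿ sum (λ j → lossOn (inputs j) r)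
      bound r (inj₁ errs) =
        ⊑-trans (errs⇒prob⊑losses r errs) (x≤y+x (·≥0 (queries (tree A r) x) (p≥0 r)))
      bound r (inj₂ 1≤q) = begin
        prob A r                        ≈⟨ +ᴿ-identityʳ (prob A r) ⟨
        1 · prob A r                    ≲⟨ ·-monoˡ-≤ (p≥0 r) (1≤q x) ⟩
        queries (tree A r) x · prob A r ≲⟨ x≤x+y (sum≥0 λ j → lossOn≥0 (inputs j) r) ⟩
        queries (tree A r) x · prob A r +ᴿ sum (λ j → lossOn (inputs j) r) ∎

    -- If all trees err, the losses alone cover the whole probability 1, whereas the errors on the
    -- domain add up to at most `n · ε`.
    boundedError⇒¬allErr : ∀ {ε} → length (domain f) · ε <ᴿ 1ᴿ → BoundedError f ε A →
                           ¬ (∀ r → Errs (tree A r))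
    boundedError⇒¬allErr {ε} nε<1 bounded errs = ⊑⇒≯ᴿ 1⊑nε nε<1
      where
      open ⊑-Reasoning
      n = length (domain f)
      1⊑nε : 1ᴿ ⊑ n · ε
      1⊑nε = begin
        1ᴿ ≲⟨ 1⊑sum+totalError (λ _ → 0ᴿ)
                (λ r → ⊑-trans (errs⇒prob⊑losses r (errs r)) (x≤y+x ⊑-refl)) ⟩
        sum {size A} (λ _ → 0ᴿ) +ᴿ totalError
          ≲⟨ +ᴿ-mono-≤ {u = totalError} (proj₁ (sum-replicate-zero (size A))) ⊑-refl ⟩
        0ᴿ +ᴿ totalError  ≈⟨ +ᴿ-identityˡ totalError ⟩
        totalError        ≲⟨ sum-mono-≤ (λ j → ≤ᴿ⇒⊑ (bounded (inputs j) (∈-domain⁻ (∈-lookup j)))) ⟩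
        sum {n} (λ _ → ε) ≈⟨ sum-replicate n ε ⟩
        n · ε             ∎

-- Uniform distributions on lists of trees

uniform : ∀ {m Z} (ts : List (Tree m Z)) .{{_ : NonZero (length ts)}} → RandomizedAlgorithm m Z
uniform ts = record
  { size   = length ts
  ; prob   = λ _ → fromℚ w
  ; prob≥0 = λ _ → ⊑⇒≤ᴿ {0ᴿ} {fromℚ w} (⊑-pointwise λ _ → ℚ.<⇒≤ 0<w)
  ; prob-1 = let p , q = ≈-trans (sum-replicate (length ts) (fromℚ w)) (≈-pointwise {y = 1ᴿ} n·w≡1)
             in ⊑⇒≤ᴿ p , ⊑⇒≤ᴿ q
  ; tree   = List.lookup ts
  }
  where
  w = proj₁ (reciprocal (length ts))
  0<w = proj₁ (proj₂ (reciprocal (length ts)))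
  n·w≡1 = proj₂ (proj₂ (reciprocal (length ts)))

totalQueries : ∀ {m Z} → List (Tree m Z) → Input m → ℕ
totalQueries ts x = ListAction.sum (List.map (λ t → queries t x) ts)

module _ {m : ℕ} {Z : Set} (f : TotalRelation m Z)
         (ts : List (Tree m Z)) .{{_ : NonZero (length ts)}} where

  uniform-zeroError : All (ZeroErrorTree f) ts → ∀ x → T (dom f x) →
                      errorProbability f (uniform ts) x ≈ 0ᴿ
  uniform-zeroError correct x x∈B = ≈-trans
    (sum-cong λ r → ≈-pointwise λ i → cong (λ b → seq (if b then 0ᴿ else prob (uniform ts) r) i)
                        (All.lookup correct (∈-lookup r) x x∈B))
    (sum-replicate-zero (length ts))

  -- All weights being 1 / N, an expected cost is a total number of queries divided by N, and the
  -- bound becomes an inequality of natural numbers.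
  uniform-maxExpectedQueries : ∀ c → (∀ {x} → T (dom f x) → totalQueries ts x ℕ.≤ c ℕ.* length ts) →
                               maxExpectedQueries f (uniform ts) ⊑ c · 1ᴿ
  uniform-maxExpectedQueries c total≤ =
    foldr-⊔ᴿ-least (expectedQueries f (uniform ts)) (domain f) (·≥0 c 0⊑1) λ x∈ → bound (∈-domain⁻ f x∈)
    where
    open ⊑-Reasoning
    0⊑1 : 0ᴿ ⊑ 1ᴿ
    0⊑1 = ⊑-pointwise λ _ → ℚ.nonNegative⁻¹ 1ℚ
    N = length ts
    w = proj₁ (reciprocal N)
    p = fromℚ w
    bound : ∀ {x} → T (dom f x) → expectedQueries f (uniform ts) x ⊑ c · 1ᴿ
    bound {x} x∈B = begin
      sum (λ r → queries (List.lookup ts r) x · p)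
        ≈⟨ ∑-· (λ r → queries (List.lookup ts r) x) p ⟩
      ListAction.sum (List.tabulate λ r → queries (List.lookup ts r) x) · p
        ≡⟨ cong (λ qs → ListAction.sum qs · p) tabulate-queries ⟩
      totalQueries ts x · p
        ≲⟨ ·-monoˡ-≤ (⊑-pointwise {0ᴿ} {p} λ _ → ℚ.<⇒≤ (proj₁ (proj₂ (reciprocal N)))) (total≤ x∈B) ⟩
      (c ℕ.* N) · p
        ≈⟨ ≈-pointwise cN·p≡c ⟩
      c · 1ᴿ ∎
      where
      cN·p≡c : ∀ i → seq ((c ℕ.* N) · p) i ≡ seq (c · 1ᴿ) i
      cN·p≡c i =
        trans (seq-· (c ℕ.* N) p i)
        (trans (sym (×ℚ-assocˡ w c N))
        (trans (cong (c ×ℚ_) (trans (sym (seq-· N p i)) (proj₂ (proj₂ (reciprocal N)) i)))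
               (sym (seq-· c 1ᴿ i))))
      tabulate-queries : List.tabulate (λ r → queries (List.lookup ts r) x)
                       ≡ List.map (λ t → queries t x) ts
      tabulate-queries = trans (sym (List.map-tabulate (List.lookup ts) (λ t → queries t x)))
                               (cong (List.map _) (List.tabulate-lookup ts))

-- Finding a one among few zeros

zeros : ∀ {m} → Input m → ℕ
zeros []          = 0
zeros (true ∷ x)  = zeros x
zeros (false ∷ x) = suc (zeros x)

zeros-ones : ∀ m → zeros (replicate m true) ≡ 0
zeros-ones zero    = refl
zeros-ones (suc m) = zeros-ones m

zeros-[]≔false : ∀ {m} (x : Input m) i → zeros (x [ i ]≔ false) ℕ.≤ suc (zeros x)
zeros-[]≔false (true ∷ x)  zero    = ℕ.≤-refl
zeros-[]≔false (false ∷ x) zero    = ℕ.n≤1+n _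
zeros-[]≔false (true ∷ x)  (suc i) = zeros-[]≔false x i
zeros-[]≔false (false ∷ x) (suc i) = s≤s (zeros-[]≔false x i)

[]≔false-preserves-false : ∀ {m} (x : Input m) i {j} → lookup x j ≡ false →
                           lookup (x [ i ]≔ false) j ≡ false
[]≔false-preserves-false x i {j} xⱼ≡false with j Fin.≟ i
... | yes refl = lookup∘update i x false
... | no j≢i   = trans (lookup∘update′ j≢i x false) xⱼ≡false

-- The adversary answers "false" to the first n questions, the final answer of
-- the tree counting as a question.
spoil : ∀ {m} → ℕ → Tree m (Fin m) → Input m → Input m
spoil zero    t           x = x
spoil (suc n) (answer z)  x = x [ z ]≔ false
spoil (suc n) (query i t) x = spoil n (t false) (x [ i ]≔ false)

zeros-spoil : ∀ {m} n (t : Tree m (Fin m)) x → zeros (spoil n t x) ℕ.≤ n ℕ.+ zeros x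
zeros-spoil zero    t           x = ℕ.≤-refl
zeros-spoil (suc n) (answer z)  x = ℕ.≤-trans (zeros-[]≔false x z) (s≤s (ℕ.m≤n+m (zeros x) n))
zeros-spoil (suc n) (query i t) x =
  ℕ.≤-trans (zeros-spoil n (t false) (x [ i ]≔ false))
  (ℕ.≤-trans (ℕ.+-monoʳ-≤ n (zeros-[]≔false x i)) (ℕ.≤-reflexive (ℕ.+-suc n (zeros x))))

spoil-preserves-false : ∀ {m} n (t : Tree m (Fin m)) x {j} → lookup x j ≡ false →
                        lookup (spoil n t x) j ≡ false
spoil-preserves-false zero    t           x eq = eq
spoil-preserves-false (suc n) (answer z)  x eq = []≔false-preserves-false x z eq
spoil-preserves-false (suc n) (query i t) x eq =
  spoil-preserves-false n (t false) _ ([]≔false-preserves-false x i eq)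

-- A bit set to false is never reset, so on the spoiled input the tree follows the very branch the
-- adversary chose. Either that branch has at least `n` queries, or its answer is among the spoiled
-- bits.
spoil-spoils : ∀ {m} n (t : Tree m (Fin m)) x → let y = spoil n t x in
               n ℕ.≤ queries t y ⊎ lookup y (output t y) ≡ false
spoil-spoils zero    t           x = inj₁ z≤n
spoil-spoils (suc n) (answer z)  x = inj₂ (lookup∘update z x false)
spoil-spoils (suc n) (query i t) x
  -- Bit `i` is still false in the final input, so the run enters `t false`.
  rewrite spoil-preserves-false n (t false) (x [ i ]≔ false) (lookup∘update i x false)
  with spoil-spoils n (t false) (x [ i ]≔ false)
... | inj₁ n≤q = inj₁ (s≤s n≤q)
... | inj₂ eq  = inj₂ eq

shift : ∀ {m} → Tree m (Fin m) → Tree (suc m) (Fin (suc m))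
shift (answer z)  = answer (suc z)
shift (query i t) = query (suc i) (λ b → shift (t b))

output-shift : ∀ {m} (t : Tree m (Fin m)) b x → output (shift t) (b ∷ x) ≡ suc (output t x)
output-shift (answer z)  b x = refl
output-shift (query i t) b x = output-shift (t (lookup x i)) b x

queries-shift : ∀ {m} (t : Tree m (Fin m)) b x → queries (shift t) (b ∷ x) ≡ queries t x
queries-shift (answer z)  b x = refl
queries-shift (query i t) b x = cong suc (queries-shift (t (lookup x i)) b x)

-- With at most `k` zeros, `k` failed queries force the next bit to be a one, and it is answered
-- unread. The cost `k` thus meets the adversary bound exactly.
scan : ∀ {m k} → k ℕ.< m → Tree m (Fin m)
scan {suc m} {zero}  _         = answer zero
scan {suc m} {suc k} (s≤s k<m) = query zero (if_then answer zero else shift (scan k<m))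

scan-correct : ∀ {m k} (k<m : k ℕ.< m) x → zeros x ℕ.≤ k →
               lookup x (output (scan k<m) x) ≡ true
scan-correct {suc m} {zero}  _         (true ∷ x)  _       = refl
scan-correct {suc m} {suc k} (s≤s k<m) (true ∷ x)  _       = refl
scan-correct {suc m} {suc k} (s≤s k<m) (false ∷ x) (s≤s p) =
  trans (cong (lookup (false ∷ x)) (output-shift (scan k<m) false x)) (scan-correct k<m x p)

queries-scan : ∀ {m k} (k<m : k ℕ.< m) x → queries (scan k<m) x ℕ.≤ k
queries-scan {suc m} {zero}  _         x           = z≤n
queries-scan {suc m} {suc k} (s≤s k<m) (true ∷ x)  = s≤s z≤n
queries-scan {suc m} {suc k} (s≤s k<m) (false ∷ x) =
  s≤s (subst (ℕ._≤ k) (sym (queries-shift (scan k<m) false x)) (queries-scan k<m x))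

-- Random probing and its cost

probe : ∀ {m} → Fin m → Tree m (Fin m) → Tree m (Fin m)
probe i t = query i (if_then answer i else t)

-- One tree for each `n`-tuple of positions: the uniform distribution on this list makes `n`
-- independent uniform probes before running `t`.
probing : ∀ {m} → ℕ → Tree m (Fin m) → List (Tree m (Fin m))
probing         zero    t = t ∷ []
probing {m = m} (suc n) t = cartesianProductWith probe (allFin m) (probing n t)

sum-cartesianProductWith : ∀ {A B C : Set} (g : C → ℕ) (h : A → B → C) xs ys →
  ListAction.sum (List.map g (cartesianProductWith h xs ys)) ≡
  ListAction.sum (List.map (λ x → ListAction.sum (List.map (λ y → g (h x y)) ys)) xs)
sum-cartesianProductWith g h []       ys = refl
sum-cartesianProductWith g h (x ∷ xs) ys =
  trans (cong ListAction.sum (List.map-++ g (List.map (h x) ys) (cartesianProductWith h xs ys)))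
  (trans (ListAction.sum-++ (List.map g (List.map (h x) ys)) _)
         (cong₂ ℕ._+_ (cong ListAction.sum (sym (List.map-∘ ys))) (sum-cartesianProductWith g h xs ys)))

length-cartesianProductWith : ∀ {A B C : Set} (h : A → B → C) xs ys →
  length (cartesianProductWith h xs ys) ≡ length xs ℕ.* length ys
length-cartesianProductWith h []       ys = refl
length-cartesianProductWith h (x ∷ xs) ys =
  trans (List.length-++ (List.map (h x) ys))
        (cong₂ ℕ._+_ (List.length-map (h x) ys) (length-cartesianProductWith h xs ys))

length-probing-suc : ∀ {m} n (t : Tree m (Fin m)) →
                     length (probing (suc n) t) ≡ m ℕ.* length (probing n t)
length-probing-suc {m} n t =
  trans (length-cartesianProductWith probe (allFin m) (probing n t))
        (cong (ℕ._* length (probing n t)) (List.length-tabulate {n = m} (λ i → i)))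

length-probing : ∀ {m} n (t : Tree m (Fin m)) → length (probing n t) ≡ m ℕ.^ n
length-probing         zero    t = refl
length-probing {m = m} (suc n) t =
  trans (length-probing-suc n t) (cong (m ℕ.*_) (length-probing n t))

totalQueries-probe : ∀ {m} (ts : List (Tree m (Fin m))) x i →
  totalQueries (List.map (probe i) ts) x ≡
  length ts ℕ.+ (if lookup x i then 0 else totalQueries ts x)
totalQueries-probe [] x i with lookup x i
... | true  = refl
... | false = refl
totalQueries-probe (t ∷ ts) x i with lookup x i | totalQueries-probe ts x i
... | true  | ih = cong suc ih
... | false | ih = cong suc (trans (cong (queries t x ℕ.+_) ih) (x∙yz≈y∙xz (queries t x) (length ts) _))
  where
  open CommutativeSemigroup (CommutativeMonoid.commutativeSemigroup ℕ.+-0-commutativeMonoid)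
    using (x∙yz≈y∙xz)

sum-allFin-zeros : ∀ {m} (x : Input m) a b →
  ListAction.sum (List.map (λ i → a ℕ.+ (if lookup x i then 0 else b)) (allFin m)) ≡
  m ℕ.* a ℕ.+ zeros x ℕ.* b
sum-allFin-zeros x a b = trans (cong ListAction.sum (List.map-tabulate (λ i → i) term)) (go x)
  where
  open CommutativeSemigroup (CommutativeMonoid.commutativeSemigroup ℕ.+-0-commutativeMonoid)
    using (interchange)
  term : Fin _ → ℕ
  term i = a ℕ.+ (if lookup x i then 0 else b)
  go : ∀ {m} (x : Input m) →
       ListAction.sum (List.tabulate λ i → a ℕ.+ (if lookup x i then 0 else b)) ≡
       m ℕ.* a ℕ.+ zeros x ℕ.* b
  go []                  = refl
  go {suc m} (true ∷ x)  =
    trans (cong (a ℕ.+ 0 ℕ.+_) (go x)) (interchange a 0 (m ℕ.* a) (zeros x ℕ.* b))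
  go {suc m} (false ∷ x) =
    trans (cong (a ℕ.+ b ℕ.+_) (go x)) (interchange a b (m ℕ.* a) (zeros x ℕ.* b))

-- Each of the `m * length (probing n t)` trees pays for its first probe, and only the `zeros x`
-- first positions holding a zero lead on to the remaining rounds.
totalQueries-probing : ∀ {m} n (t : Tree m (Fin m)) x →
  totalQueries (probing (suc n) t) x ≡
  m ℕ.* length (probing n t) ℕ.+ zeros x ℕ.* totalQueries (probing n t) x
totalQueries-probing {m} n t x =
  trans (sum-cartesianProductWith (λ t → queries t x) probe (allFin m) ts)
  (trans (cong ListAction.sum (List.map-cong (λ i →
            trans (cong ListAction.sum (List.map-∘ ts)) (totalQueries-probe ts x i)) (allFin m)))
         (sum-allFin-zeros x (length ts) (totalQueries ts x)))
  where ts = probing n t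

-- A round costs one query and fails with probability at most ½, which turns an
-- expected cost c into at most 1 + c / 2: the fixed point 2 gives the constant,
-- and the cost of the final tree t is halved n times.
totalQueries-probing-bound : ∀ {m} n (t : Tree m (Fin m)) x → 2 ℕ.* zeros x ℕ.≤ m →
  2 ℕ.^ n ℕ.* totalQueries (probing n t) x ℕ.≤
  (2 ℕ.* 2 ℕ.^ n ℕ.+ queries t x) ℕ.* length (probing n t)
totalQueries-probing-bound zero t x _ = begin
  1 ℕ.* (q ℕ.+ 0)      ≡⟨ solve 1 (λ q → con 1 :* (q :+ con 0) := q) refl q ⟩
  q                    ≤⟨ ℕ.m≤n+m q 2 ⟩
  2 ℕ.+ q              ≡⟨ ℕ.*-identityʳ (2 ℕ.+ q) ⟨
  (2 ℕ.+ q) ℕ.* 1      ∎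
  where
  open ℕ.≤-Reasoning
  open +-*-Solver
  q = queries t x
totalQueries-probing-bound {m} (suc n) t x 2z≤m = begin
  2 ℕ.* e ℕ.* totalQueries (probing (suc n) t) x
    ≡⟨ cong (2 ℕ.* e ℕ.*_) (totalQueries-probing n t x) ⟩
  2 ℕ.* e ℕ.* (m ℕ.* l ℕ.+ z ℕ.* c)
    ≡⟨ solve 5 (λ e m l z c → con 2 :* e :* (m :* l :+ z :* c)
                           := con 2 :* e :* (m :* l) :+ con 2 :* z :* (e :* c)) refl e m l z c ⟩
  2 ℕ.* e ℕ.* (m ℕ.* l) ℕ.+ 2 ℕ.* z ℕ.* (e ℕ.* c)
    -- The new factor 2 is spent on `2 * zeros x ≤ m`, while `2 ^ n` goes to the induction
    -- hypothesis.
    ≤⟨ ℕ.+-monoʳ-≤ (2 ℕ.* e ℕ.* (m ℕ.* l))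
         (ℕ.*-mono-≤ 2z≤m (totalQueries-probing-bound n t x 2z≤m)) ⟩
  2 ℕ.* e ℕ.* (m ℕ.* l) ℕ.+ m ℕ.* ((2 ℕ.* e ℕ.+ q) ℕ.* l)
    ≡⟨ solve 4 (λ e m l q → con 2 :* e :* (m :* l) :+ m :* ((con 2 :* e :+ q) :* l)
                         := (con 2 :* (con 2 :* e) :+ q) :* (m :* l)) refl e m l q ⟩
  (2 ℕ.* (2 ℕ.* e) ℕ.+ q) ℕ.* (m ℕ.* l)
    ≡⟨ cong ((2 ℕ.* (2 ℕ.* e) ℕ.+ q) ℕ.*_) (length-probing-suc n t) ⟨
  (2 ℕ.* (2 ℕ.* e) ℕ.+ q) ℕ.* length (probing (suc n) t) ∎
  where
  open ℕ.≤-Reasoning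
  open +-*-Solver
  e = 2 ℕ.^ n
  l = length (probing n t)
  z = zeros x
  c = totalQueries (probing n t) x
  q = queries t x

-- Ensures that `m` halvings reduce the cost of a scan, which is less than `m`, to at most 1.
n≤2^n : ∀ n → n ℕ.≤ 2 ℕ.^ n
n≤2^n zero    = z≤n
n≤2^n (suc n) = ℕ.+-mono-≤ (ℕ.m^n>0 2 n) (ℕ.≤-trans (n≤2^n n) (ℕ.m≤m+n (2 ℕ.^ n) 0))

-- The search relation and its complexities

module FindOne {m k : ℕ} (k<m : k ℕ.< m) where

  relation : TotalRelation m (Fin m)
  relation = record
    { dom      = λ x → zeros x ℕ.≤ᵇ k
    ; rel      = λ x z → (zeros x ℕ.≤ᵇ k) ∧ lookup x z
    ; rel⊆dom  = λ x z → proj₁ ∘ T-∧ .to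
    ; nonempty = replicate m true
               , ℕ.≤⇒≤ᵇ (subst (ℕ._≤ k) (sym (zeros-ones m)) z≤n)
    -- The deterministic scan supplies the position of a one.
    ; total    = λ x x∈B → output (scan k<m) x
               , T-∧ .from (x∈B , T-≡ .from (scan-correct k<m x (ℕ.≤ᵇ⇒≤ _ _ x∈B)))
    }

  lookup⇒rel : ∀ x {z} → T (dom relation x) → lookup x z ≡ true → rel relation x z ≡ true
  lookup⇒rel x x∈B xz = cong₂ _∧_ (T-≡ .to x∈B) xz

  -- Starting from all ones, the adversary creates at most `n ≤ k` zeros and so stays inside the
  -- domain.
  spoiled-errs : ∀ {n} t → n ℕ.≤ k → let y = spoil n t (replicate m true) in
                 T (dom relation y) × (lookup y (output t y) ≡ false → Errs relation t)
  spoiled-errs {n} t n≤k = y∈B , λ eq → y , y∈B , trans (cong (dom relation y ∧_) eq) (∧-zeroʳ (dom relation y))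
    where
    y = spoil n t (replicate m true)
    y∈B : T (dom relation y)
    y∈B = ℕ.≤⇒≤ᵇ (ℕ.≤-trans (zeros-spoil n t (replicate m true))
            (subst (λ z → n ℕ.+ z ℕ.≤ k) (sym (zeros-ones m))
              (subst (ℕ._≤ k) (sym (ℕ.+-identityʳ n)) n≤k)))

  -- Fewer than `k` queries together with the final answer are at most `k` questions, which the
  -- adversary can afford.
  shallow⇒errs : ∀ t → (∀ {x} → T (dom relation x) → queries t x ℕ.< k) → Errs relation t
  shallow⇒errs t q<k with spoil-spoils k t (replicate m true)
  ... | inj₁ k≤q = contradiction k≤q (ℕ.<⇒≱ (q<k (proj₁ (spoiled-errs t ℕ.≤-refl))))
  ... | inj₂ eq  = proj₂ (spoiled-errs t ℕ.≤-refl) eq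

  errs⊎queries : 1 ℕ.≤ k → ∀ t → Errs relation t ⊎ (∀ x → 1 ℕ.≤ queries t x)
  errs⊎queries 1≤k t@(answer z)  =
    -- Without queries the answer is a constant `z`; a single zero, placed at `z`, refutes it.
    inj₁ (proj₂ (spoiled-errs t 1≤k) (lookup∘update z (replicate m true) false))
  errs⊎queries 1≤k (query i t) = inj₂ λ _ → s≤s z≤n

  scan-zeroError : ZeroErrorTree relation (scan k<m)
  scan-zeroError x x∈B = lookup⇒rel x x∈B (scan-correct k<m x (ℕ.≤ᵇ⇒≤ _ _ x∈B))

  probing-zeroError : ∀ n {t} → ZeroErrorTree relation t →
                      All (ZeroErrorTree relation) (probing n t)
  probing-zeroError zero        correct = correct ∷ []
  probing-zeroError (suc n) {t} correct =
    All.tabulate λ t∈ x x∈B → case ∈-cartesianProductWith⁻ probe (allFin m) (probing n t) t∈ of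
      λ { (i , u , _ , u∈ , refl) →
          probe-correct i u x x∈B (All.lookup (probing-zeroError n correct) u∈ x x∈B) }
    where
    probe-correct : ∀ i u x → T (dom relation x) → rel relation x (output u x) ≡ true →
                    rel relation x (output (probe i u) x) ≡ true
    probe-correct i u x x∈B u-correct with lookup x i in eq
    ... | true  = lookup⇒rel x x∈B eq
    ... | false = u-correct

  -- Small enough for the errors on all of B to add up to less than 1.
  ε : ℚ
  ε = proj₁ (reciprocal (2 ℕ.+ length (domain relation)))

  0<ε : 0ℚ ℚ.< ε
  0<ε = proj₁ (proj₂ (reciprocal (2 ℕ.+ length (domain relation))))

  -- Of the `2 + ∣B∣` copies of `ε` that make up 1, one is left as the gap. Dropping terms from the
  -- rest gives both `ε < 1` and `∣B∣ · ε < 1`.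
  1+∣B∣·ε<1 : suc (length (domain relation)) · fromℚ ε <ᴿ 1ᴿ
  1+∣B∣·ε<1 = ·-<-1 (suc (length (domain relation))) 0<ε
                (proj₂ (proj₂ (reciprocal (2 ℕ.+ length (domain relation)))))

  ε⊒0 : 0ᴿ ⊑ fromℚ ε
  ε⊒0 = ⊑-pointwise λ _ → ℚ.<⇒≤ 0<ε

  ε<1 : fromℚ ε <ᴿ 1ᴿ
  ε<1 = ⊑-<ᴿ-trans {fromℚ ε} {suc (length (domain relation)) · fromℚ ε} {1ᴿ}
          (x≤x+y (·≥0 (length (domain relation)) ε⊒0)) 1+∣B∣·ε<1

  ∣B∣·ε<1 : length (domain relation) · fromℚ ε <ᴿ 1ᴿ
  ∣B∣·ε<1 = ⊑-<ᴿ-trans {length (domain relation) · fromℚ ε}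
              {suc (length (domain relation)) · fromℚ ε} {1ᴿ} (x≤y+x ε⊒0) 1+∣B∣·ε<1

  -- Below `k` queries every tree errs somewhere on the domain, which the choice of `ε` excludes.
  k≤maxQueries : ∀ A → BoundedError relation (fromℚ ε) A → k ℕ.≤ maxQueries relation A
  k≤maxQueries A bounded with k ℕ.≤? maxQueries relation A
  ... | yes k≤ = k≤
  ... | no  k≰ = ⊥-elim (boundedError⇒¬allErr relation A {fromℚ ε} ∣B∣·ε<1 bounded λ r →
          shallow⇒errs (tree A r) λ x∈B →
            ℕ.≤-<-trans (queries≤maxQueries relation A x∈B r) (ℕ.≰⇒> k≰))

  isR : IsR relation (fromℚ ε) k
  -- The lower bound, applied to the scan itself, makes its cost exactly `k`.
  isR = (A , bounded , ℕ.≤-antisym A≤k (k≤maxQueries A bounded)) , k≤maxQueries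
    where
    A = uniform (scan k<m ∷ [])
    bounded : BoundedError relation (fromℚ ε) A
    bounded x x∈B = ⊑⇒≤ᴿ {errorProbability relation A x} {fromℚ ε}
      (⊑-trans (proj₁ (uniform-zeroError relation (scan k<m ∷ []) (scan-zeroError ∷ []) x x∈B)) ε⊒0)
    A≤k : maxQueries relation A ℕ.≤ k
    A≤k = maxQueries≤ relation A λ { {x} _ zero → queries-scan k<m x }

  1≤R̄₀ : 1 ℕ.≤ k → fromℚᵘ 1ℚ ≤ᵘ R̄₀ relation
  1≤R̄₀ 1≤k q ((A , zeroErr) , A<q) = fromℚ-cancel-< {1ℚ} {q}
    (⊑-<ᴿ-trans {1ᴿ} {maxExpectedQueries relation A} {fromℚ q}
      (zeroError⇒1⊑max relation A zeroErr (errs⊎queries 1≤k ∘ tree A)) A<q)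

  R̄₀≤3 : 2 ℕ.* k ℕ.≤ m → R̄₀ relation ≤ᵘ fromℚᵘ (toℚ 3)
  R̄₀≤3 2k≤m q 3<q = (A , zeroErr) , A<q
    where
    -- After `m` rounds the scan contributes at most 1 on average, on top of the 2 for the probes.
    ts = probing m (scan k<m)
    instance
      m≢0 : NonZero m
      m≢0 = ℕ.>-nonZero (ℕ.≤-<-trans z≤n k<m)
      ∣ts∣≢0 : NonZero (length ts)
      ∣ts∣≢0 = subst NonZero (sym (length-probing m (scan k<m))) (ℕ.m^n≢0 m m)
    A = uniform ts
    zeroErr : ZeroError relation A
    zeroErr x x∈B =
      let p , q = uniform-zeroError relation ts (probing-zeroError m scan-zeroError) x x∈B
      in ⊑⇒≤ᴿ p , ⊑⇒≤ᴿ q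
    cost : ∀ {x} → T (dom relation x) → totalQueries ts x ℕ.≤ 3 ℕ.* length ts
    cost {x} x∈B = ℕ.*-cancelˡ-≤ (2 ℕ.^ m) {{ℕ.m^n≢0 2 m}} (begin
      2 ℕ.^ m ℕ.* totalQueries ts x
        ≤⟨ totalQueries-probing-bound m (scan k<m) x (ℕ.≤-trans (ℕ.*-monoʳ-≤ 2 (ℕ.≤ᵇ⇒≤ (zeros x) k x∈B)) 2k≤m) ⟩
      (2 ℕ.* 2 ℕ.^ m ℕ.+ queries (scan k<m) x) ℕ.* length ts
        ≤⟨ ℕ.*-monoˡ-≤ (length ts) (ℕ.+-monoʳ-≤ (2 ℕ.* 2 ℕ.^ m) scan≤2^m) ⟩
      (2 ℕ.* 2 ℕ.^ m ℕ.+ 2 ℕ.^ m) ℕ.* length ts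
        ≡⟨ solve 2 (λ e l → (con 2 :* e :+ e) :* l := e :* (con 3 :* l)) refl (2 ℕ.^ m) (length ts) ⟩
      2 ℕ.^ m ℕ.* (3 ℕ.* length ts) ∎)
      where
      open ℕ.≤-Reasoning
      open +-*-Solver
      scan≤2^m : queries (scan k<m) x ℕ.≤ 2 ℕ.^ m
      scan≤2^m = ℕ.≤-trans (queries-scan k<m x) (ℕ.≤-trans (ℕ.<⇒≤ k<m) (n≤2^n m))
    A<q : maxExpectedQueries relation A <ᴿ fromℚ q
    -- `3 · 1ᴿ` computes to the constant sequence `toℚ 3`.
    A<q = ⊑-<ᴿ-trans {maxExpectedQueries relation A} {3 · 1ᴿ} {fromℚ q}
            (uniform-maxExpectedQueries relation ts 3 cost) (fromℚ-mono-< 3<q)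

-- Halving and the asymptotic constants

half< : ∀ m .{{_ : NonZero m}} → ℕ.⌊ m /2⌋ ℕ.< m
half< (suc m) = ℕ.⌊n/2⌋<n m

2*half≤ : ∀ m → 2 ℕ.* ℕ.⌊ m /2⌋ ℕ.≤ m
2*half≤ m = begin
  ℕ.⌊ m /2⌋ ℕ.+ (ℕ.⌊ m /2⌋ ℕ.+ 0) ≡⟨ cong (ℕ.⌊ m /2⌋ ℕ.+_) (ℕ.+-identityʳ ℕ.⌊ m /2⌋) ⟩
  ℕ.⌊ m /2⌋ ℕ.+ ℕ.⌊ m /2⌋         ≤⟨ ℕ.+-monoʳ-≤ ℕ.⌊ m /2⌋ (ℕ.⌊n/2⌋≤⌈n/2⌉ m) ⟩
  ℕ.⌊ m /2⌋ ℕ.+ ℕ.⌈ m /2⌉         ≡⟨ ℕ.⌊n/2⌋+⌈n/2⌉≡n m ⟩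
  m                               ∎
  where open ℕ.≤-Reasoning

≤3*half : ∀ m → 2 ℕ.≤ m → m ℕ.≤ 3 ℕ.* ℕ.⌊ m /2⌋
≤3*half m 2≤m = begin
  m                                ≡⟨ ℕ.⌊n/2⌋+⌈n/2⌉≡n m ⟨
  -- The ceiling is `⌊ suc m /2⌋`, at most `⌊ suc (suc m) /2⌋`, which is `suc h`; then `2 ≤ m` gives
  -- `1 ≤ h`.
  h ℕ.+ ℕ.⌈ m /2⌉                  ≤⟨ ℕ.+-monoʳ-≤ h (ℕ.⌊n/2⌋-mono (ℕ.n≤1+n (suc m))) ⟩
  h ℕ.+ suc h                      ≤⟨ ℕ.+-monoʳ-≤ h (ℕ.+-monoˡ-≤ h (ℕ.⌊n/2⌋-mono 2≤m)) ⟩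
  h ℕ.+ (h ℕ.+ h)                  ≡⟨ cong (λ n → h ℕ.+ (h ℕ.+ n)) (ℕ.+-identityʳ h) ⟨
  3 ℕ.* h                          ∎
  where
  open ℕ.≤-Reasoning
  h = ℕ.⌊ m /2⌋

⅓ : ℚ
⅓ = + 1 ℚ./ 3

⅓*toℚ≤toℚ : ∀ {m n} → m ℕ.≤ 3 ℕ.* n → ⅓ ℚ.* toℚ m ℚ.≤ toℚ n
⅓*toℚ≤toℚ {m} {n} m≤3n = ℚ.toℚᵘ-cancel-≤ (begin
  ℚ.toℚᵘ (⅓ ℚ.* toℚ m)              ≃⟨ ℚ.toℚᵘ-homo-* ⅓ (toℚ m) ⟩
  ℚ.toℚᵘ ⅓ ℚᵘ.* ℚ.toℚᵘ (toℚ m)      ≃⟨ ℚᵘ.*-congˡ {ℚ.toℚᵘ ⅓} (toℚᵘ-toℚ m) ⟩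
  ℚ.toℚᵘ ⅓ ℚᵘ.* ℚᵘ.mkℚᵘ (+ m) 0     ≤⟨ ℚᵘ.*≤* ineq ⟩
  ℚᵘ.mkℚᵘ (+ n) 0                   ≃⟨ toℚᵘ-toℚ n ⟨
  ℚ.toℚᵘ (toℚ n)                    ∎)
  where
  open ℚᵘ.≤-Reasoning
  toℚᵘ-toℚ : ∀ n → ℚ.toℚᵘ (toℚ n) ℚᵘ.≃ ℚᵘ.mkℚᵘ (+ n) 0
  toℚᵘ-toℚ n = ℚ.toℚᵘ-fromℚᵘ (ℚᵘ.mkℚᵘ (+ n) 0)
  ineq : (+ 1 ℤ.* + m) ℤ.* + 1 ℤ.≤ + n ℤ.* + 3
  ineq = subst₂ ℤ._≤_
    (sym (trans (ℤ.*-identityʳ (+ 1 ℤ.* + m)) (ℤ.*-identityˡ (+ m))))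
    (trans (ℤ.pos-* 3 n) (ℤ.*-comm (+ 3) (+ n)))
    (ℤ.+≤+ m≤3n)

fact3 : Σ[ f ∈ ((m : ℕ) → .{{_ : NonZero m}} → TotalRelation m (Fin m)) ]
    Σ[ ε ∈ ((m : ℕ) → .{{_ : NonZero m}} → ℝ) ]
    Σ[ R ∈ ((m : ℕ) → .{{_ : NonZero m}} → ℕ) ]
    (∀ m .{{_ : NonZero m}} → 0ᴿ <ᴿ ε m × ε m <ᴿ 1ᴿ)
    × (∀ m .{{_ : NonZero m}} → IsR (f m) (ε m) (R m))
    × (λ m → R̄₀ (f m)) ∈Θ (λ _ → 1)
    × R ∈Ω (λ m → m)
fact3 =
    (λ m → FindOne.relation (half< m))
  , (λ m → fromℚ (FindOne.ε (half< m)))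
  , (λ m → ℕ.⌊ m /2⌋)
  , (λ m → fromℚ-mono-< (FindOne.0<ε (half< m)) , FindOne.ε<1 (half< m))
  , (λ m → FindOne.isR (half< m))
  -- The threshold 2 is where `⌊ m /2⌋` becomes positive; at `m = 1` the only position can be
  -- answered without a query.
  , (1ℚ , toℚ 3 , ℚ.positive⁻¹ 1ℚ , ℚ.positive⁻¹ (toℚ 3) , 2 , λ m 2≤m →
      FindOne.1≤R̄₀ (half< m) (ℕ.⌊n/2⌋-mono 2≤m) , FindOne.R̄₀≤3 (half< m) (2*half≤ m))
  -- The constant allows for rounding: at `m = 3` the half is 1.
  , (⅓ , ℚ.positive⁻¹ ⅓ , 2 , λ m 2≤m → ⅓*toℚ≤toℚ {m} {ℕ.⌊ m /2⌋} (≤3*half m 2≤m))
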